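{- Let $y\in X$ and let $f_{y=*}:\overline{\mathcal{G}(\mathcal{T})}\to\overline{\mathcal{G}(\mathcal{T})}$ be the (extended) non-deterministic assignment transfer function. For any $\emptyset\neq S\subseteq\overline{\mathcal{G}(\mathcal{T})}$, $f_{y=*}(\bigwedge S)=\bigwedge f_{y=*}(S)$, where $f_{y=*}(S)=\{f_{y=*}(s):s\in S\}$.
   Context: $C$ is a countable set of constants, $X$ a countable set of variables, and $\mathcal{T}$ is the set of formal expressions (terms) given by $t::=c\mid x\mid (t+t)$ with $c\in C$, $x\in X$. $t[x\leftarrow\alpha]$ denotes the term obtained from $t$ by replacing every occurrence of the variable $x$ by the term $\alpha$. $\mathcal{T}(y)$ is the set of terms in which $y$ appears. For a partition $\mathcal{P}$ of $\mathcal{T}$ write $t\cong_{\mathcal{P}}t'$ if $t,t'$ lie in the same class. $\mathcal{P}$ is a congruence if: (1) distinct constants $c\neq c'$ satisfy $c\ncong_{\mathcal P} c'$; (2) for all $t,t',s,s'\in\mathcal{T}$, ($t'\cong_{\mathcal P} t$ and $s'\cong_{\mathcal P} s$) if and only if $t'+s'\cong_{\mathcal P} t+s$; (3) for $c\in C$, $t\in\mathcal{T}$, if $t\cong_{\mathcal P} c$ then $t=c$ or $t\in X$. $\mathcal{G}(\mathcal{T})$ is the set of all congruences, ordered by refinement: $\mathcal{P}\preceq\mathcal{P}'$ if each class of $\mathcal{P}$ is contained in a class of $\mathcal{P}'$. $\overline{\mathcal{G}(\mathcal{T})}=\mathcal{G}(\mathcal{T})\cup\{\top\}$ where $\top$ is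 an added element with $\mathcal{P}\preceq\top$ for all $\mathcal{P}$; it is a complete lattice, and $\bigwedge$ denotes greatest lower bound in it. For $\mathcal{P}\in\mathcal{G}(\mathcal{T})$, $f_{y=*}(\mathcal{P})$ is the congruence in which $t$ and $t'$ are congruent if and only if $t\cong_{\mathcal{P}}t'$ and, for every $\beta\in\mathcal{T}\setminus\mathcal{T}(y)$, $t[y\leftarrow\beta]\cong_{\mathcal{P}}t'[y\leftarrow\beta]$. The extended function additionally sends $\top$ to $\top$. -}

module Defs where

open import Axiom.ExcludedMiddle using (ExcludedMiddle)
open import Data.Empty using (⊥-elim)
open import Data.Maybe.Base as Maybe using ()
open import Data.Nat.Base using (ℕ)
open import Data.Nat.Properties using (eq?)
open import Data.Product using (_×_; _,_; proj₁; proj₂; ∃-syntax)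
open import Data.Sum using (_⊎_)
open import Function.Bundles using (_↣_; _⇔_; mk⇔; Equivalence)
open import Level using (Level; 0ℓ; _⊔_; Lift; lift; lower) renaming (suc to lsuc)
open import Relation.Binary.Core using (Rel)
open import Relation.Binary.Construct.Add.Supremum.NonStrict using (_≤⁺_; [_]; _≤⊤⁺)
open import Relation.Binary.PropositionalEquality using (_≡_; _≢_; refl)
open import Relation.Binary.Structures using (IsEquivalence)
open import Relation.Nullary using (¬_; Dec; yes; no)
open import Relation.Nullary.Construct.Add.Supremum using (_⁺; ⊤⁺; [_])
open import Relation.Nullary.Decidable using (True; toWitness; fromWitness)
open import Relation.Unary using (Pred; _∈_; _∉_; _⊆_)

-- Countable means finite or countably infinite: an injection into ℕ.  It is
-- also what makes equality of variables decidable, as substitution requires.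
Countable : Set → Set
Countable A = A ↣ ℕ

module Expressions {C X : Set} (C-countable : Countable C) (X-countable : Countable X) where

  infixl 6 _⊕_

  data 𝒯 : Set where
    con : C → 𝒯
    var : X → 𝒯
    _⊕_ : 𝒯 → 𝒯 → 𝒯

  data 𝒯⟨_⟩ (y : X) : Pred 𝒯 0ℓ where
    here  : var y ∈ 𝒯⟨ y ⟩
    left  : ∀ {t s} → t ∈ 𝒯⟨ y ⟩ → t ⊕ s ∈ 𝒯⟨ y ⟩
    right : ∀ {t s} → s ∈ 𝒯⟨ y ⟩ → t ⊕ s ∈ 𝒯⟨ y ⟩

  infixl 9 _[_←_]

  _[_←_] : 𝒯 → X → 𝒯 → 𝒯
  con c   [ x ← α ] = con c
  var z   [ x ← α ] with eq? X-countable z x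
  ... | yes _ = α
  ... | no  _ = var z
  (t ⊕ s) [ x ← α ] = t [ x ← α ] ⊕ s [ x ← α ]

  -- A partition of 𝒯 is given by the equivalence relation "in the same class".
  record IsCongruence {ℓ} (_≅_ : Rel 𝒯 ℓ) : Set ℓ where
    field
      isEquivalence : IsEquivalence _≅_
      constants     : ∀ {c c′} → c ≢ c′ → ¬ (con c ≅ con c′)
      sums          : ∀ {t t′ s s′} → (t′ ≅ t × s′ ≅ s) ⇔ ((t′ ⊕ s′) ≅ (t ⊕ s))
      constantClass : ∀ {c t} → t ≅ con c → t ≡ con c ⊎ (∃[ x ] t ≡ var x)

    open IsEquivalence isEquivalence public

  record 𝒢 (ℓ : Level) : Set (lsuc ℓ) where
    infix 4 _≅_

    field
      _≅_          : Rel 𝒯 ℓ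
      isCongruence : IsCongruence _≅_

    open IsCongruence isCongruence public

    class : 𝒯 → Pred 𝒯 ℓ
    class t s = s ≅ t

  infix 4 _≼_ _≼⁺_

  _≼_ : ∀ {ℓ} → Rel (𝒢 ℓ) ℓ
  P ≼ P′ = ∀ t → ∃[ t′ ] 𝒢.class P t ⊆ 𝒢.class P′ t′

  𝒢⁺ : (ℓ : Level) → Set (lsuc ℓ)
  𝒢⁺ ℓ = 𝒢 ℓ ⁺

  _≼⁺_ : ∀ {ℓ} → Rel (𝒢⁺ ℓ) (lsuc ℓ)
  _≼⁺_ = _≤⁺_ _≼_

  infix 4 _IsMeetOf_

  -- m = ⋀ S.  As the order is antisymmetric only up to having the same
  -- classes, this determines m exactly as a partition.
  record _IsMeetOf_ {ℓ ℓ′} (m : 𝒢⁺ ℓ) (S : Pred (𝒢⁺ ℓ) ℓ′) : Set (lsuc ℓ ⊔ ℓ′) where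
    field
      lowerBound : ∀ {s} → s ∈ S → m ≼⁺ s
      greatest   : ∀ {n} → (∀ {s} → s ∈ S → n ≼⁺ s) → n ≼⁺ m

  infix 5 _⟪_⟫

  _⟪_⟫ : ∀ {ℓ ℓ′} → (𝒢⁺ ℓ → 𝒢⁺ ℓ) → Pred (𝒢⁺ ℓ) ℓ′ → Pred (𝒢⁺ ℓ) (lsuc ℓ ⊔ ℓ′)
  (f ⟪ S ⟫) r = ∃[ s ] s ∈ S × r ≡ f s

  assignAny₀ : ∀ {ℓ} → X → 𝒢 ℓ → 𝒢 ℓ
  assignAny₀ y P = record
    { _≅_ = λ t t′ → t P.≅ t′ × (∀ β → β ∉ 𝒯⟨ y ⟩ → t [ y ← β ] P.≅ t′ [ y ← β ])
    ; isCongruence = record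
      { isEquivalence = record
        { refl  = P.refl , λ _ _ → P.refl
        ; sym   = λ (p , q) → P.sym p , λ β β∉ → P.sym (q β β∉)
        ; trans = λ (p , q) (p′ , q′) → P.trans p p′ , λ β β∉ → P.trans (q β β∉) (q′ β β∉)
        }
      ; constants = λ c≢c′ (p , _) → P.constants c≢c′ p
      ; sums = mk⇔
          (λ ((p , q) , (p′ , q′)) → join (p , p′) , λ β β∉ → join (q β β∉ , q′ β β∉))
          (λ (p , q) → (proj₁ (split p) , λ β β∉ → proj₁ (split (q β β∉)))
                     , (proj₂ (split p) , λ β β∉ → proj₂ (split (q β β∉))))
      ; constantClass = λ (p , _) → P.constantClass p
      }
    }
    where
    module P = 𝒢 P
    join : ∀ {t t′ s s′} → t′ P.≅ t × s′ P.≅ s → (t′ ⊕ s′) P.≅ (t ⊕ s)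
    join = Equivalence.to P.sums
    split : ∀ {t t′ s s′} → (t′ ⊕ s′) P.≅ (t ⊕ s) → t′ P.≅ t × s′ P.≅ s
    split = Equivalence.from P.sums

  -- The transfer function f_{y=*} of the non-deterministic assignment y := *.
  assignAny : ∀ {ℓ} → X → 𝒢⁺ ℓ → 𝒢⁺ ℓ
  assignAny y = Maybe.map (assignAny₀ y)

  -- Classically every S has a meet, i.e. 𝒢⁺ is a complete lattice.  Excluded
  -- middle decides whether S contains a congruence at all, and brings the
  -- intersection of the members of S down to level ℓ.
  meet-exists : ∀ {ℓ ℓ′} → ExcludedMiddle (lsuc ℓ ⊔ ℓ′) →
                (S : Pred (𝒢⁺ ℓ) ℓ′) → ∃[ m ] m IsMeetOf S
  meet-exists {ℓ} {ℓ′} em S with em {∃[ P ] [ P ] ∈ S}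
  ... | no none = ⊤⁺ , record { lowerBound = lower⊤ _ ; greatest = λ _ → _ ≤⊤⁺ }
    where
    lower⊤ : ∀ s → s ∈ S → ⊤⁺ ≼⁺ s
    lower⊤ ⊤⁺    _ = _ ≤⊤⁺
    lower⊤ [ P ] p = ⊥-elim (none (P , p))
  ... | yes (P₀ , P₀∈S) = [ M ] , record { lowerBound = lowerM _ ; greatest = greatestM _ }
    where
    All : Rel 𝒯 (lsuc ℓ ⊔ ℓ′)
    All t t′ = ∀ P → [ P ] ∈ S → 𝒢._≅_ P t t′

    infix 4 _≅_
    _≅_ : Rel 𝒯 ℓ
    t ≅ t′ = Lift ℓ (True (em {All t t′}))

    out : ∀ {t t′} → t ≅ t′ → All t t′
    out p = toWitness (lower p)

    into : ∀ {t t′} → All t t′ → t ≅ t′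
    into p = lift (fromWitness p)

    M : 𝒢 ℓ
    M = record
      { _≅_ = _≅_
      ; isCongruence = record
        { isEquivalence = record
          { refl  = into λ P _ → 𝒢.refl P
          ; sym   = λ p → into λ P i → 𝒢.sym P (out p P i)
          ; trans = λ p q → into λ P i → 𝒢.trans P (out p P i) (out q P i)
          }
        ; constants = λ c≢c′ p → 𝒢.constants P₀ c≢c′ (out p P₀ P₀∈S)
        ; sums = mk⇔
            (λ (p , q) → into λ P i → Equivalence.to (𝒢.sums P) (out p P i , out q P i))
            (λ p → into (λ P i → proj₁ (Equivalence.from (𝒢.sums P) (out p P i)))
                 , into (λ P i → proj₂ (Equivalence.from (𝒢.sums P) (out p P i))))
        ; constantClass = λ p → 𝒢.constantClass P₀ (out p P₀ P₀∈S)
        }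
      }

    lowerM : ∀ s → s ∈ S → [ M ] ≼⁺ s
    lowerM ⊤⁺    _ = _ ≤⊤⁺
    lowerM [ P ] i = [ (λ t → t , λ p → out p P i) ]

    greatestM : ∀ n → (∀ {s} → s ∈ S → n ≼⁺ s) → n ≼⁺ [ M ]
    greatestM ⊤⁺    low with () ← low P₀∈S
    greatestM [ Q ] low = [ (λ t → t , λ q → into λ P i → below P (low i) q) ]
      where
      below : ∀ P {s t} → [ Q ] ≼⁺ [ P ] → 𝒢._≅_ Q s t → 𝒢._≅_ P s t
      below P {t = t} [ Q≼P ] q with (_ , sub) ← Q≼P t =
        𝒢.trans P (sub q) (𝒢.sym P (sub (𝒢.refl Q)))

{-# OPTIONS --safe #-}

-- The meet of S, when it is a congruence, is the intersection of the
-- congruences in S, and assignAny y commutes with intersections.  To see the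
-- former constructively, let t, t′ be related by every congruence in S.  The
-- congruence generated by the single pair (t, t′) is then a lower bound of S,
-- hence lies below the meet.  That it separates constants follows from its
-- being contained in some congruence of S.  Such a congruence cannot fail to
-- exist, since otherwise the meet would be ⊤; and this double negation is
-- enough, because equality of constants is decidable.
module Submission where

open import Defs
open import Data.Empty using (⊥; ⊥-elim)
open import Data.Nat.Properties using (eq?)
open import Data.Product using (_,_; proj₁; proj₂; ∃-syntax)
open import Data.Sum using (inj₁; inj₂)
open import Function.Bundles using (mk⇔; Equivalence)
open import Level using (Level)
open import Relation.Binary.Construct.Add.Supremum.NonStrict using ([_]; _≤⊤⁺)
open import Relation.Binary.Core using (Rel; _⇒_)
open import Relation.Binary.PropositionalEquality using (_≢_; refl; cong)
open import Relation.Nullary using (¬_; yes; no)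
open import Relation.Nullary.Construct.Add.Supremum using (⊤⁺; [_])
open import Relation.Unary using (Pred; Satisfiable; _∈_)

module _ {C X : Set} (C-countable : Countable C) (X-countable : Countable X) where

  open Expressions C-countable X-countable

  -- Refinement only provides some class of `Q` containing the class of `t`, with an unknown
  -- representative. Since `t` lies in its own class, both elements are related to that
  -- representative, hence to each other.
  ≼⇒⇒ : ∀ {ℓ} (P Q : 𝒢 ℓ) → P ≼ Q → 𝒢._≅_ P ⇒ 𝒢._≅_ Q
  ≼⇒⇒ P Q P≼Q {_} {t} p with _ , sub ← P≼Q t =
    𝒢.trans Q (sub p) (𝒢.sym Q (sub (𝒢.refl P)))

  ⇒⇒≼ : ∀ {ℓ} (P Q : 𝒢 ℓ) → 𝒢._≅_ P ⇒ 𝒢._≅_ Q → P ≼ Q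
  ⇒⇒≼ P Q P⇒Q t = t , P⇒Q

  ≼⁺⇒⇒ : ∀ {ℓ} (P Q : 𝒢 ℓ) → [ P ] ≼⁺ [ Q ] → 𝒢._≅_ P ⇒ 𝒢._≅_ Q
  ≼⁺⇒⇒ P Q [ P≼Q ] = ≼⇒⇒ P Q P≼Q

  -- Only the equivalence laws and the two directions of `sums` are closure conditions; the other
  -- two congruence axioms have to be proved. The parameter `ℓ` places the relation at the level of
  -- the congruences it is compared with.
  data Generated (ℓ : Level) (a b : 𝒯) : Rel 𝒯 ℓ where
    generator  : Generated ℓ a b a b
    reflexive  : ∀ {t} → Generated ℓ a b t t
    symmetric  : ∀ {t s} → Generated ℓ a b t s → Generated ℓ a b s t
    transitive : ∀ {t s r} → Generated ℓ a b t s → Generated ℓ a b s r →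
                 Generated ℓ a b t r
    sum        : ∀ {t t′ s s′} → Generated ℓ a b t′ t → Generated ℓ a b s′ s →
                 Generated ℓ a b (t′ ⊕ s′) (t ⊕ s)
    summandˡ   : ∀ {t t′ s s′} → Generated ℓ a b (t′ ⊕ s′) (t ⊕ s) →
                 Generated ℓ a b t′ t
    summandʳ   : ∀ {t t′ s s′} → Generated ℓ a b (t′ ⊕ s′) (t ⊕ s) →
                 Generated ℓ a b s′ s

  module _ {ℓ : Level} {a b : 𝒯} where

    generated-least : (P : 𝒢 ℓ) → 𝒢._≅_ P a b → Generated ℓ a b ⇒ 𝒢._≅_ P
    generated-least P ab generator        = ab
    generated-least P ab reflexive        = 𝒢.refl P
    generated-least P ab (symmetric p)    = 𝒢.sym P (generated-least P ab p)
    generated-least P ab (transitive p q) =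
      𝒢.trans P (generated-least P ab p) (generated-least P ab q)
    generated-least P ab (sum p q)        =
      Equivalence.to (𝒢.sums P) (generated-least P ab p , generated-least P ab q)
    generated-least P ab (summandˡ p)     =
      proj₁ (Equivalence.from (𝒢.sums P) (generated-least P ab p))
    generated-least P ab (summandʳ p)     =
      proj₂ (Equivalence.from (𝒢.sums P) (generated-least P ab p))

    generated-isCongruence : ¬ ¬ (∃[ P ] 𝒢._≅_ {ℓ} P a b) →
                             IsCongruence (Generated ℓ a b)
    generated-isCongruence consistent = record
      { isEquivalence = record
        { refl = reflexive ; sym = symmetric ; trans = transitive }
      ; constants     = separated
      ; sums          = mk⇔ (λ (p , q) → sum p q) (λ p → summandˡ p , summandʳ p)
      ; constantClass = constantClass _ _
      }
      where
      separated : ∀ {c c′} → c ≢ c′ → ¬ Generated ℓ a b (con c) (con c′)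
      separated c≢c′ p = consistent λ (P , ab) →
        𝒢.constants P c≢c′ (generated-least P ab p)

      sum≇constant : ∀ {t s c} → ¬ Generated ℓ a b (t ⊕ s) (con c)
      sum≇constant p = consistent λ (P , ab) →
        absurd P (generated-least P ab p)
        where
        absurd : ∀ (P : 𝒢 ℓ) {t s c} → 𝒢._≅_ P (t ⊕ s) (con c) → ⊥
        absurd P p with 𝒢.constantClass P p
        ... | inj₁ ()
        ... | inj₂ (_ , ())

      constantClass : ∀ c t → Generated ℓ a b t (con c) → _
      -- `separated` can only refute, so the positive conclusion needs a decision, which the
      -- injection of `C` into ℕ supplies.
      constantClass c (con c′) p with eq? C-countable c′ c
      ... | yes c′≡c = inj₁ (cong con c′≡c)
      ... | no  c′≢c = ⊥-elim (separated c′≢c p)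
      constantClass c (var x) p = inj₂ (x , refl)
      constantClass c (t ⊕ s) p = ⊥-elim (sum≇constant p)

  module _ {ℓ ℓ′ : Level} {S : Pred (𝒢⁺ ℓ) ℓ′} {M : 𝒢 ℓ} (M-meet : [ M ] IsMeetOf S) where

    open _IsMeetOf_ M-meet

    meet-inhabited : ¬ ¬ (∃[ P ] [ P ] ∈ S)
    meet-inhabited none = ⊤⋠M (greatest (⊤-lower _))
      where
      ⊤⋠M : ¬ (⊤⁺ ≼⁺ [ M ])
      ⊤⋠M ()

      ⊤-lower : ∀ s → s ∈ S → ⊤⁺ ≼⁺ s
      ⊤-lower ⊤⁺    _ = _ ≤⊤⁺
      ⊤-lower [ P ] i = ⊥-elim (none (P , i))

    -- The intersection of `S` quantifies over `𝒢 ℓ` and so may live above level `ℓ`, where it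
    -- cannot be compared with `M`. The congruence generated by one pair stays at level `ℓ`, and its
    -- generator carries the pair into `M`.
    intersection⇒meet : ∀ {a b} → (∀ P → [ P ] ∈ S → 𝒢._≅_ P a b) → 𝒢._≅_ M a b
    intersection⇒meet {a} {b} ab = ≼⁺⇒⇒ G M (greatest (G-lower _)) generator
      where
      G : 𝒢 ℓ
      G = record
        { isCongruence = generated-isCongruence {ℓ} {a} {b} λ none →
            meet-inhabited λ (P , i) → none (P , ab P i)
        }

      G-lower : ∀ s → s ∈ S → [ G ] ≼⁺ s
      G-lower ⊤⁺    _ = _ ≤⊤⁺
      G-lower [ P ] i = [ ⇒⇒≼ G P (generated-least P (ab P i)) ]

  assignAny-mono : ∀ {ℓ} y (P Q : 𝒢⁺ ℓ) → P ≼⁺ Q → assignAny y P ≼⁺ assignAny y Q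
  assignAny-mono y P     ⊤⁺    _       = _ ≤⊤⁺
  assignAny-mono y [ P ] [ Q ] [ P≼Q ] =
    [ ⇒⇒≼ (assignAny₀ y P) (assignAny₀ y Q)
        (λ (p , q) → ≼⇒⇒ P Q P≼Q p , λ β β∉ → ≼⇒⇒ P Q P≼Q (q β β∉)) ]

  assignAny-greatest : ∀ {ℓ ℓ′} y (S : Pred (𝒢⁺ ℓ) ℓ′) m → m IsMeetOf S →
    ∀ n → (∀ s → s ∈ S → n ≼⁺ assignAny y s) → n ≼⁺ assignAny y m
  assignAny-greatest y S ⊤⁺    m-meet n     low = _ ≤⊤⁺
  -- `⊤⁺` cannot be a lower bound here: `S` cannot lack congruences, and `assignAny` sends
  -- congruences to congruences.
  assignAny-greatest y S [ M ] m-meet ⊤⁺    low =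
    ⊥-elim (meet-inhabited m-meet λ (P , i) → ⊤⋠ P (low [ P ] i))
    where
    ⊤⋠ : ∀ P → ¬ (⊤⁺ ≼⁺ assignAny y [ P ])
    ⊤⋠ P ()
  -- A pair related by `N` is related in every congruence of `S`, and so are its instances for each
  -- admissible `β`. Each of these pairs passes to `M` separately.
  assignAny-greatest y S [ M ] m-meet [ N ] low =
    [ ⇒⇒≼ N (assignAny₀ y M) (λ p →
        intersection⇒meet m-meet (λ P i → proj₁ (below P i p)) ,
        λ β β∉ → intersection⇒meet m-meet (λ P i → proj₂ (below P i p) β β∉)) ]
    where
    below : ∀ P → [ P ] ∈ S → 𝒢._≅_ N ⇒ 𝒢._≅_ (assignAny₀ y P)
    below P i = ≼⁺⇒⇒ N (assignAny₀ y P) (low [ P ] i)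

theorem7p5 : ∀ {C X : Set} (C-countable : Countable C) (X-countable : Countable X) →
    let open Expressions C-countable X-countable in
    ∀ {ℓ ℓ′} (y : X) (S : Pred (𝒢⁺ ℓ) ℓ′) → Satisfiable S →
    ∀ (⋀S : 𝒢⁺ ℓ) → ⋀S IsMeetOf S →
    assignAny y ⋀S IsMeetOf (assignAny y ⟪ S ⟫)
theorem7p5 C-countable X-countable y S _ ⋀S ⋀S-meet = record
  { lowerBound = λ { (s , s∈S , refl) →
      assignAny-mono C-countable X-countable y ⋀S s (lowerBound s∈S) }
  ; greatest = λ {n} low →
      assignAny-greatest C-countable X-countable y S ⋀S ⋀S-meet n
        (λ s s∈S → low (s , s∈S , refl))
  }
  where
  open Expressions C-countable X-countable
  open _IsMeetOf_ ⋀S-meet
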